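{- Let $s\ge 1$ and let $G$ be a metric star with center $c$ and $s$ spikes $cv_i$ of length one, for $i\in\{1,\dots,s\}$. Let $G_w$ be any graph obtained by adding $s-1$ wormholes to $G$. Then for some $i$ we have $d_{G_w}(c,v_i)=1$, and consequently $\mathrm{diam}(G_w)\ge 1$. This bound is tight: for every $s$ there is a choice of $s-1$ wormholes for which $\mathrm{diam}(G_w)=1$.
   Context: A metric graph is a finite edge-weighted graph regarded as a metric space in which all points in the interior of each edge are included and each edge is locally isometric to an interval whose length is the edge weight; $d_G(x,y)$ is the minimum length of a path from $x$ to $y$, and $\mathrm{diam}(G)=\max_{x,y\in G} d_G(x,y)$ over all points of $G$ (not only vertices). The metric star with $s$ spikes of length one consists of $s$ intervals $cv_i$ of length $1$ glued at the common endpoint $c$. A wormhole is a pair of points of $G$ (arbitrary points, not necessarily vertices); adding a wormhole means identifying its two points, equivalently adding an edge of length zero between them. $G_w$ is the metric graph obtained after all the identifications; points of $G$ are regarded as points of $G_w$ via the projection. Different wormholes may share points. -}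

module Defs where

open import Algebra.Bundles using (CommutativeRing)
import Algebra.Properties.Group as GroupProperties
import Algebra.Properties.Ring as RingProperties
open import Data.Fin.Base using (Fin; zero; suc)
open import Data.Nat.Base using (ℕ; suc)
open import Data.Product.Base using (∃; _×_; _,_; proj₁; proj₂)
open import Data.Sum.Base using (inj₁; inj₂)
open import Level using (0ℓ) renaming (suc to lsuc)
open import Relation.Binary.Core using (Rel)
open import Relation.Binary.Structures using (IsTotalOrder)
open import Relation.Nullary.Negation.Core using (¬_)

-- The real numbers, given axiomatically as a Dedekind-complete ordered field.
-- Classically there is exactly one up to isomorphism; `inverse`, the totality
-- of the order and `supremum` are the classical axioms, so a model (such as
-- Dedekind cuts valued in Bool) needs excluded middle.
record RealNumbers : Set (lsuc 0ℓ) where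
  infix 4 _≤_ _<_
  field
    commutativeRing : CommutativeRing 0ℓ 0ℓ

  open CommutativeRing commutativeRing public renaming (Carrier to ℝ)

  field
    _≤_          : Rel ℝ 0ℓ
    isTotalOrder : IsTotalOrder _≈_ _≤_
    0≉1          : ¬ (0# ≈ 1#)
    inverse      : ∀ x → ¬ (x ≈ 0#) → ∃ λ y → x * y ≈ 1#
    +-monoʳ-≤    : ∀ x {y z} → y ≤ z → x + y ≤ x + z
    *-nonneg     : ∀ {x y} → 0# ≤ x → 0# ≤ y → 0# ≤ x * y

  UpperBound : (ℝ → Set) → ℝ → Set
  UpperBound P b = ∀ x → P x → x ≤ b

  field
    supremum : (P : ℝ → Set) → ∃ P → ∃ (UpperBound P) →
               ∃ λ m → UpperBound P m × (∀ b → UpperBound P b → m ≤ b)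

  open IsTotalOrder isTotalOrder public
    using (total; antisym; ≤-respˡ-≈; ≤-respʳ-≈)
    renaming (refl to ≤-refl; trans to ≤-trans; reflexive to ≤-reflexive)

  _<_ : Rel ℝ 0ℓ
  x < y = x ≤ y × ¬ (x ≈ y)

  0≤1 : 0# ≤ 1#
  0≤1 with total 0# 1#
  ... | inj₁ 0≤1′ = 0≤1′
  ... | inj₂ 1≤0  = ≤-respʳ-≈ -1*-1≈1 (*-nonneg 0≤-1 0≤-1)
    where
    0≤-1 : 0# ≤ - 1#
    0≤-1 = ≤-respˡ-≈ (-‿inverseˡ 1#)
             (≤-respʳ-≈ (+-identityʳ (- 1#)) (+-monoʳ-≤ (- 1#) 1≤0))
    -1*-1≈1 : - 1# * - 1# ≈ 1#
    -1*-1≈1 = trans (RingProperties.-1*x≈-x ring (- 1#))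
                    (GroupProperties.⁻¹-involutive +-group 1#)

  0<1 : 0# < 1#
  0<1 = 0≤1 , 0≉1

module MetricGraphs (R : RealNumbers) where
  open RealNumbers R hiding (zero)

  record MetricGraph : Set where
    field
      #V #E    : ℕ
      source   : Fin #E → Fin #V
      target   : Fin #E → Fin #V
      weight   : Fin #E → ℝ
      0<weight : ∀ e → 0# < weight e

  open MetricGraph

  -- `onEdge e t` is the point of edge e at distance t along e from its source.
  -- The endpoints of an edge are not equated with the vertices here: points
  -- that coincide in the metric space are joined by steps of length zero below.
  data Point (G : MetricGraph) : Set where
    vertex : Fin (#V G) → Point G
    onEdge : (e : Fin (#E G)) (t : ℝ) → 0# ≤ t → t ≤ weight G e → Point G

  Wormhole : MetricGraph → Set
  Wormhole G = Point G × Point G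

  Wormholes : MetricGraph → ℕ → Set
  Wormholes G k = Fin k → Wormhole G

  -- The metric graph G_w obtained from G by the identifications w.  Its points
  -- are the points of G, taken up to the identifications; Step and Path
  -- describe travel in G_w, indexed by length.
  module _ {G : MetricGraph} {k : ℕ} (w : Wormholes G k) where

    data Step : Point G → Point G → ℝ → Set where
      forward    : ∀ {e t u 0≤t t≤w 0≤u u≤w} → t ≤ u →
                   Step (onEdge e t 0≤t t≤w) (onEdge e u 0≤u u≤w) (u - t)
      backward   : ∀ {e t u 0≤t t≤w 0≤u u≤w} → u ≤ t →
                   Step (onEdge e t 0≤t t≤w) (onEdge e u 0≤u u≤w) (t - u)
      fromSource : ∀ {e t 0≤t t≤w} → t ≈ 0# →
                   Step (vertex (source G e)) (onEdge e t 0≤t t≤w) 0#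
      toSource   : ∀ {e t 0≤t t≤w} → t ≈ 0# →
                   Step (onEdge e t 0≤t t≤w) (vertex (source G e)) 0#
      fromTarget : ∀ {e t 0≤t t≤w} → t ≈ weight G e →
                   Step (vertex (target G e)) (onEdge e t 0≤t t≤w) 0#
      toTarget   : ∀ {e t 0≤t t≤w} → t ≈ weight G e →
                   Step (onEdge e t 0≤t t≤w) (vertex (target G e)) 0#
      jump       : ∀ j → Step (proj₁ (w j)) (proj₂ (w j)) 0#
      jumpBack   : ∀ j → Step (proj₂ (w j)) (proj₁ (w j)) 0#

    infixr 5 _▸_

    data Path : Point G → Point G → ℝ → Set where
      stay : ∀ {x} → Path x x 0#
      _▸_  : ∀ {x y z a b} → Step x y a → Path y z b → Path x z (a + b)

    -- d_{G_w}(x , y) = d: the minimum of the path lengths.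
    IsDistance : Point G → Point G → ℝ → Set
    IsDistance x y d = (∃ λ ℓ → Path x y ℓ × ℓ ≈ d)
                     × (∀ ℓ → Path x y ℓ → d ≤ ℓ)

    -- diam(G_w) = D: the maximum of the distances, all of which must exist.
    IsDiameter : ℝ → Set
    IsDiameter D = (∃ λ x → ∃ λ y → IsDistance x y D)
                 × (∀ x y → ∃ λ d → IsDistance x y d × d ≤ D)

  star : ℕ → MetricGraph
  star s = record
    { #V       = suc s
    ; #E       = s
    ; source   = λ _ → zero
    ; target   = suc
    ; weight   = λ _ → 1#
    ; 0<weight = λ _ → 0<1
    }

  centre : ∀ {s} → Point (star s)
  centre = vertex zero

  tip : ∀ {s} → Fin s → Point (star s)
  tip i = vertex (suc i)

{-# OPTIONS --safe #-}

-- Distances in G_w are computed by adding the wormholes one at a time: after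
-- adding (p , q), the new distance from x to y is the least of d x y,
-- d x p + d q y and d x q + d p y.
--
-- Lower bound: call a set of spikes separated if their tips are pairwise at
-- distance ≥ 2 and at distance ≥ 1 from the centre.  All spikes are separated
-- before any wormhole is added, and adding (p , q) to a separated set can only
-- spoil one spike, the one whose tip is closest to {p , q}: two tips of the
-- set cannot both be at distance < 1 from p.  So s - 1 wormholes leave one
-- spike at full length.
--
-- The diameter exists because a 1-Lipschitz function on a metric graph attains
-- its maximum, applied in each of the two arguments of the distance.  For
-- tightness, identify all tips: points at heights t and u are then joined by a
-- path of length t + u via the centre and one of length 2 - t - u via the tips.

module Submission where

open import Defs
import Algebra.Construct.NaturalChoice.Max as Max
import Algebra.Construct.NaturalChoice.Min as Min
import Algebra.Properties.CommutativeSemigroup as CommutativeSemigroupProperties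
open import Axiom.ExcludedMiddle using (ExcludedMiddle)
open import Data.Empty using (⊥; ⊥-elim)
open import Data.Fin.Base using (Fin; zero; suc; punchIn)
open import Data.Fin.Properties using (_≟_; punchIn-injective; punchInᵢ≢i)
import Data.List.Extrema as Extrema
open import Data.List.Base using (List; allFin; map; _++_)
open import Data.List.Membership.Propositional using (_∈_)
open import Data.List.Membership.Propositional.Properties
  using (∈-allFin; ∈-map⁺; ∈-++⁺ˡ; ∈-++⁺ʳ)
import Data.List.Relation.Unary.All as All
open import Data.Nat.Base as ℕ using (ℕ; NonZero; pred)
import Data.Nat.Properties as ℕ
open import Data.Product.Base using (∃; _×_; _,_; proj₁; proj₂)
open import Data.Sum.Base using (inj₁; inj₂; [_,_]′)
open import Function.Base using (_∘_; id)
open import Level using (0ℓ)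
open import Relation.Binary.Bundles using (TotalOrder)
open import Relation.Binary.PropositionalEquality.Core as ≡ using (_≡_; _≢_)
import Relation.Binary.Reasoning.PartialOrder as PartialOrderReasoning
open import Relation.Nullary.Decidable.Core using (Dec; yes; no)
open import Relation.Nullary.Negation.Core using (¬_)

-- Inequalities in an ordered field.

module OrderedField (R : RealNumbers) where
  open RealNumbers R hiding (zero)
  open CommutativeSemigroupProperties +-commutativeSemigroup using (x∙yz≈y∙xz)

  totalOrder : TotalOrder 0ℓ 0ℓ 0ℓ
  totalOrder = record { isTotalOrder = isTotalOrder }

  open PartialOrderReasoning (TotalOrder.poset totalOrder)
  open Min totalOrder using (_⊓_; minOperator)
  open import Algebra.Construct.NaturalChoice.MinOp minOperator using (⊓-sel)

  +-monoˡ-≤ : ∀ x {y z} → y ≤ z → y + x ≤ z + x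
  +-monoˡ-≤ x {y} {z} y≤z = begin
    y + x ≈⟨ +-comm y x ⟩
    x + y ≤⟨ +-monoʳ-≤ x y≤z ⟩
    x + z ≈⟨ +-comm x z ⟩
    z + x ∎

  +-mono-≤ : ∀ {x y u v} → x ≤ y → u ≤ v → x + u ≤ y + v
  +-mono-≤ {y = y} {u} x≤y u≤v = ≤-trans (+-monoˡ-≤ u x≤y) (+-monoʳ-≤ y u≤v)

  -x+[x+y]≈y : ∀ x y → - x + (x + y) ≈ y
  -x+[x+y]≈y x y = trans (sym (+-assoc (- x) x y))
                     (trans (+-congʳ (-‿inverseˡ x)) (+-identityˡ y))

  [y-x]+x≈y : ∀ x y → (y - x) + x ≈ y
  [y-x]+x≈y x y = trans (+-assoc y (- x) x)
                    (trans (+-congˡ (-‿inverseˡ x)) (+-identityʳ y))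

  +-cancelˡ-≤ : ∀ x {y z} → x + y ≤ x + z → y ≤ z
  +-cancelˡ-≤ x {y} {z} x+y≤x+z = begin
    y               ≈⟨ -x+[x+y]≈y x y ⟨
    - x + (x + y)   ≤⟨ +-monoʳ-≤ (- x) x+y≤x+z ⟩
    - x + (x + z)   ≈⟨ -x+[x+y]≈y x z ⟩
    z               ∎

  +-cancelʳ-≤ : ∀ x {y z} → y + x ≤ z + x → y ≤ z
  +-cancelʳ-≤ x {y} {z} y+x≤z+x = +-cancelˡ-≤ x (begin
    x + y ≈⟨ +-comm x y ⟩
    y + x ≤⟨ y+x≤z+x ⟩
    z + x ≈⟨ +-comm z x ⟩
    x + z ∎)

  x≤y+z⇒x-z≤y : ∀ {x y z} → x ≤ y + z → x - z ≤ y
  x≤y+z⇒x-z≤y {x} {y} {z} x≤y+z =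
    +-cancelʳ-≤ z (≤-trans (≤-reflexive ([y-x]+x≈y z x)) x≤y+z)

  x-z≤y⇒x≤y+z : ∀ {x y z} → x - z ≤ y → x ≤ y + z
  x-z≤y⇒x≤y+z {x} {y} {z} x-z≤y =
    ≤-trans (≤-reflexive (sym ([y-x]+x≈y z x))) (+-monoˡ-≤ z x-z≤y)

  0≤y-x : ∀ {x y} → x ≤ y → 0# ≤ y - x
  0≤y-x {x} {y} x≤y = +-cancelʳ-≤ x (begin
    0# + x       ≈⟨ +-identityˡ x ⟩
    x            ≤⟨ x≤y ⟩
    y            ≈⟨ [y-x]+x≈y x y ⟨
    (y - x) + x  ∎)

  ≤-stepˡ : ∀ {x y z} → 0# ≤ x → y ≤ z → y ≤ x + z
  ≤-stepˡ 0≤x y≤z = ≤-respˡ-≈ (+-identityˡ _) (+-mono-≤ 0≤x y≤z)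

  +-nonneg : ∀ {x y} → 0# ≤ x → 0# ≤ y → 0# ≤ x + y
  +-nonneg = ≤-stepˡ

  +-nonposˡ : ∀ {x y z} → x ≤ 0# → y ≤ z → x + y ≤ z
  +-nonposˡ x≤0 y≤z = ≤-respʳ-≈ (+-identityˡ _) (+-mono-≤ x≤0 y≤z)

  +-halving-≤ : ∀ {x y} → x + x ≤ y + y → x ≤ y
  +-halving-≤ {x} {y} 2x≤2y with total x y
  ... | inj₁ x≤y = x≤y
  ... | inj₂ y≤x = +-cancelʳ-≤ x (≤-trans 2x≤2y (+-monoʳ-≤ y y≤x))

  half : ∀ x → ∃ λ h → h + h ≈ x
  half x = x * ½ , (begin-equality
    x * ½ + x * ½         ≈⟨ distribˡ x ½ ½ ⟨
    x * (½ + ½)           ≈⟨ *-congˡ (+-cong (*-identityˡ ½) (*-identityˡ ½)) ⟨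
    x * (1# * ½ + 1# * ½) ≈⟨ *-congˡ (distribʳ ½ 1# 1#) ⟨
    x * ((1# + 1#) * ½)   ≈⟨ *-congˡ (proj₂ 2⁻¹) ⟩
    x * 1#                ≈⟨ *-identityʳ x ⟩
    x                     ∎)
    where
    2≉0 : ¬ (1# + 1# ≈ 0#)
    -- Here `1# ≤ 1# + 1# ≈ 0#`, against `0≤1` and `0≉1`.
    2≉0 2≈0 = 0≉1 (antisym 0≤1 (≤-respʳ-≈ 2≈0 (≤-stepˡ 0≤1 ≤-refl)))
    2⁻¹ = inverse (1# + 1#) 2≉0
    ½   = proj₁ 2⁻¹

  ≤+⊓ : ∀ {x a u v} → x ≤ a + u → x ≤ a + v → x ≤ a + (u ⊓ v)
  ≤+⊓ {u = u} {v} x≤a+u x≤a+v with ⊓-sel u v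
  ... | inj₁ u⊓v≈u = ≤-respʳ-≈ (+-congˡ (sym u⊓v≈u)) x≤a+u
  ... | inj₂ u⊓v≈v = ≤-respʳ-≈ (+-congˡ (sym u⊓v≈v)) x≤a+v

  open Max totalOrder using (_⊔_; maxOperator)
  open import Algebra.Construct.NaturalChoice.MaxOp maxOperator
    using (x≤x⊔y; x≤y⊔x; ⊔-lub)

  gap : ℝ → ℝ → ℝ
  gap t u = (t - u) ⊔ (u - t)

  t≤gap+u : ∀ t u → t ≤ gap t u + u
  t≤gap+u t u = x-z≤y⇒x≤y+z (x≤x⊔y (t - u) (u - t))

  u≤gap+t : ∀ t u → u ≤ gap t u + t
  u≤gap+t t u = x-z≤y⇒x≤y+z (x≤y⊔x (t - u) (u - t))

  -- The two hypotheses together are the subtraction-free form of |t - u| ≤ r, which serves as the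
  -- Lipschitz hypothesis from here on.
  gap≤ : ∀ {t u r} → t ≤ r + u → u ≤ r + t → gap t u ≤ r
  gap≤ t≤r+u u≤r+t = ⊔-lub (x≤y+z⇒x-z≤y t≤r+u) (x≤y+z⇒x-z≤y u≤r+t)

  gap-lipschitz : ∀ {t u v r} → t ≤ r + u → u ≤ r + t → gap t v ≤ r + gap u v
  gap-lipschitz {t} {u} {v} {r} t≤r+u u≤r+t = gap≤
    (begin
      t                   ≤⟨ t≤r+u ⟩
      r + u               ≤⟨ +-monoʳ-≤ r (t≤gap+u u v) ⟩
      r + (gap u v + v)   ≈⟨ +-assoc r _ v ⟨
      (r + gap u v) + v   ∎)
    (begin
      v                   ≤⟨ u≤gap+t u v ⟩
      gap u v + u         ≤⟨ +-monoʳ-≤ _ u≤r+t ⟩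
      gap u v + (r + t)   ≈⟨ x∙yz≈y∙xz _ r t ⟩
      r + (gap u v + t)   ≈⟨ +-assoc r _ t ⟨
      (r + gap u v) + t   ∎)

  -- Extrema of finite families and of Lipschitz functions on an interval.

  minimiser : ∀ {n} (f : Fin (ℕ.suc n) → ℝ) → ∃ λ i → ∀ j → f i ≤ f j
  minimiser f = Extrema.argmin totalOrder f zero (allFin _) , λ j →
    All.lookup (Extrema.f[argmin]≤f[xs] totalOrder {f = f} zero (allFin _)) (∈-allFin j)

  Interval : ℝ → Set
  Interval b = ∃ λ t → 0# ≤ t × t ≤ b

  -- If c is the supremum of the x ∈ [0 , b] such that every value of f is
  -- matched by a value on [x , b], then f is maximal at c: were f y > f c, the
  -- Lipschitz bound would push the matching points beyond c + (f y - f c) / 2.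
  lipschitz-attains-max :
    ExcludedMiddle 0ℓ → ∀ {b} → 0# ≤ b → (f : Interval b → ℝ) →
    (∀ {r} y z → proj₁ y ≤ r + proj₁ z → proj₁ z ≤ r + proj₁ y → f y ≤ r + f z) →
    ∃ λ c → ∀ y → f y ≤ f c
  lipschitz-attains-max em {b} 0≤b f f-lipschitz = c̄ , maximal
    where
    Matched : ℝ → Set
    Matched x = (0# ≤ x × x ≤ b) × (∀ y → ∃ λ z → x ≤ proj₁ z × f y ≤ f z)

    matched-0 : Matched 0#
    matched-0 = (≤-refl , 0≤b) , λ y → y , proj₁ (proj₂ y) , ≤-refl

    sup = supremum Matched (0# , matched-0) (b , λ _ → proj₂ ∘ proj₁)

    c : ℝ
    c = proj₁ sup

    c̄ : Interval b
    c̄ = c , proj₁ (proj₂ sup) 0# matched-0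
          , proj₂ (proj₂ sup) b (λ _ → proj₂ ∘ proj₁)

    module _ (y : Interval b) (fy≰fc : ¬ (f y ≤ f c̄)) where
      δ = proj₁ (half (f y - f c̄))

      fy≤2δ+fc : f y ≤ δ + (δ + f c̄)
      fy≤2δ+fc = begin
        f y                     ≈⟨ [y-x]+x≈y (f c̄) (f y) ⟨
        (f y - f c̄) + f c̄       ≈⟨ +-congʳ (proj₂ (half (f y - f c̄))) ⟨
        (δ + δ) + f c̄           ≈⟨ +-assoc δ δ _ ⟩
        δ + (δ + f c̄)           ∎

      2δ+fc≤fy : δ + (δ + f c̄) ≤ f y
      2δ+fc≤fy = begin
        δ + (δ + f c̄)           ≈⟨ +-assoc δ δ _ ⟨
        (δ + δ) + f c̄           ≈⟨ +-congʳ (proj₂ (half (f y - f c̄))) ⟩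
        (f y - f c̄) + f c̄       ≈⟨ [y-x]+x≈y (f c̄) (f y) ⟩
        f y                     ∎

      δ≰0 : ¬ (δ ≤ 0#)
      δ≰0 δ≤0 = fy≰fc (≤-trans fy≤2δ+fc (+-nonposˡ δ≤0 (+-nonposˡ δ≤0 ≤-refl)))

      δ+x≰x : ∀ {x} → ¬ (δ + x ≤ x)
      δ+x≰x {x} δ+x≤x =
        δ≰0 (+-cancelʳ-≤ x (≤-trans δ+x≤x (≤-reflexive (sym (+-identityˡ x)))))

      0≤δ : 0# ≤ δ
      0≤δ with total 0# δ
      ... | inj₁ 0≤δ′ = 0≤δ′
      ... | inj₂ δ≤0  = ⊥-elim (δ≰0 δ≤0)

      -- A point `z` within `δ` of `c` has `f z ≤ δ + f c̄` by the Lipschitz condition, whereas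
      -- `f z` is at least `f y`, which equals `δ + (δ + f c̄)`.
      far-right : ∀ z → c ≤ δ + proj₁ z → f y ≤ f z → δ + c ≤ proj₁ z
      far-right z c≤δ+z fy≤fz with total (δ + c) (proj₁ z)
      ... | inj₁ δ+c≤z = δ+c≤z
      ... | inj₂ z≤δ+c = ⊥-elim (δ+x≰x (begin
        δ + (δ + f c̄)   ≤⟨ 2δ+fc≤fy ⟩
        f y             ≤⟨ fy≤fz ⟩
        f z             ≤⟨ f-lipschitz z c̄ z≤δ+c c≤δ+z ⟩
        δ + f c̄         ∎))

      -- For values of at least `f y`, the match provided by `x` lies beyond `δ + c` by `far-right`;
      -- smaller values are matched by the point found for `y` itself.
      matched-far-right : ∀ {x} → c ≤ δ + x → Matched x → Matched (δ + c)
      matched-far-right {x} c≤δ+x (_ , match) =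
        ( +-nonneg 0≤δ (proj₁ (proj₂ c̄))
        , ≤-trans (proj₁ (proj₂ far)) (proj₂ (proj₂ (proj₁ far)))) , match′
        where
        match-from : ∀ y′ → f y ≤ f y′ → ∃ λ z → δ + c ≤ proj₁ z × f y′ ≤ f z
        match-from y′ fy≤fy′ with match y′
        ... | z , x≤z , fy′≤fz =
          z , far-right z (≤-trans c≤δ+x (+-monoʳ-≤ δ x≤z)) (≤-trans fy≤fy′ fy′≤fz)
            , fy′≤fz

        far = match-from y ≤-refl

        match′ : ∀ y′ → ∃ λ z → δ + c ≤ proj₁ z × f y′ ≤ f z
        match′ y′ with total (f y) (f y′)
        ... | inj₁ fy≤fy′ = match-from y′ fy≤fy′
        ... | inj₂ fy′≤fy =
          proj₁ far , proj₁ (proj₂ far) , ≤-trans fy′≤fy (proj₂ (proj₂ far))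

      -- A matched `x` at or above `c - δ` would make `δ + c` matched, beyond the supremum `c`.
      c-δ-bounds : UpperBound Matched (c - δ)
      c-δ-bounds x mx with total x (c - δ)
      ... | inj₁ x≤c-δ = x≤c-δ
      ... | inj₂ c-δ≤x = ⊥-elim (δ+x≰x (proj₁ (proj₂ sup) (δ + c)
              (matched-far-right
                (≤-trans (x-z≤y⇒x≤y+z c-δ≤x) (≤-reflexive (+-comm x δ))) mx)))

      not-maximal-absurd : ⊥
      not-maximal-absurd = δ+x≰x (begin
        δ + c         ≈⟨ +-comm δ c ⟩
        c + δ         ≤⟨ +-monoˡ-≤ δ (proj₂ (proj₂ sup) (c - δ) c-δ-bounds) ⟩
        (c - δ) + δ   ≈⟨ [y-x]+x≈y δ c ⟩
        c             ∎)

    maximal : ∀ y → f y ≤ f c̄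
    -- Totality of the order does not decide this inequality; excluded middle turns the refutation
    -- of its negation into a proof.
    maximal y with em {f y ≤ f c̄}
    ... | yes fy≤fc = fy≤fc
    ... | no  fy≰fc = ⊥-elim (not-maximal-absurd y fy≰fc)

-- Paths, reachability and Lipschitz functions on a metric graph.

module Travel (R : RealNumbers) where
  open RealNumbers R hiding (zero)
  open MetricGraphs R
  open OrderedField R
  open PartialOrderReasoning (TotalOrder.poset totalOrder)
  open Min totalOrder using (_⊓_; minOperator)
  open import Algebra.Construct.NaturalChoice.MinOp minOperator
    using (⊓-sel; x⊓y≤x; x⊓y≤y)
  open MetricGraph

  module _ {G : MetricGraph} {k : ℕ} {w : Wormholes G k} where

    step-nonneg : ∀ {x y a} → Step w x y a → 0# ≤ a
    step-nonneg (forward t≤u)  = 0≤y-x t≤u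
    step-nonneg (backward u≤t) = 0≤y-x u≤t
    step-nonneg (fromSource _) = ≤-refl
    step-nonneg (toSource _)   = ≤-refl
    step-nonneg (fromTarget _) = ≤-refl
    step-nonneg (toTarget _)   = ≤-refl
    step-nonneg (jump _)       = ≤-refl
    step-nonneg (jumpBack _)   = ≤-refl

    path-nonneg : ∀ {x y ℓ} → Path w x y ℓ → 0# ≤ ℓ
    path-nonneg stay    = ≤-refl
    path-nonneg (s ▸ π) = +-nonneg (step-nonneg s) (path-nonneg π)

    reverse-step : ∀ {x y a} → Step w x y a → Step w y x a
    reverse-step (forward t≤u)    = backward t≤u
    reverse-step (backward u≤t)   = forward u≤t
    reverse-step (fromSource t≈0) = toSource t≈0
    reverse-step (toSource t≈0)   = fromSource t≈0
    reverse-step (fromTarget t≈w) = toTarget t≈w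
    reverse-step (toTarget t≈w)   = fromTarget t≈w
    reverse-step (jump j)         = jumpBack j
    reverse-step (jumpBack j)     = jump j

  module _ {G : MetricGraph} {k : ℕ} (w : Wormholes G k) where

    -- Path lengths are indices of a type, whereas reals are equated by `≈`; a bound on the length
    -- can be rewritten along `≈`.
    Reach : Point G → Point G → ℝ → Set
    Reach x y r = ∃ λ ℓ → Path w x y ℓ × ℓ ≤ r

    Lipschitz : (Point G → ℝ) → Set
    Lipschitz f = ∀ {x y a} → Step w x y a → f x ≤ a + f y

  module _ {G : MetricGraph} {k : ℕ} {w : Wormholes G k} where

    reach-refl : ∀ {x} → Reach w x x 0#
    reach-refl = 0# , stay , ≤-refl

    reach-weaken : ∀ {x y r r′} → r ≤ r′ → Reach w x y r → Reach w x y r′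
    reach-weaken r≤r′ (ℓ , π , ℓ≤r) = ℓ , π , ≤-trans ℓ≤r r≤r′

    reach-cons : ∀ {x y z a r} → Step w x y a → Reach w y z r → Reach w x z (a + r)
    reach-cons {a = a} s (ℓ , π , ℓ≤r) = a + ℓ , s ▸ π , +-monoʳ-≤ a ℓ≤r

    reach-step : ∀ {x y a} → Step w x y a → Reach w x y a
    reach-step s = reach-weaken (≤-reflexive (+-identityʳ _)) (reach-cons s reach-refl)

    path-reach-trans : ∀ {x y z ℓ r} → Path w x y ℓ → Reach w y z r → Reach w x z (ℓ + r)
    path-reach-trans stay    ρ = reach-weaken (≤-reflexive (sym (+-identityˡ _))) ρ
    path-reach-trans (s ▸ π) ρ = reach-weaken (≤-reflexive (sym (+-assoc _ _ _)))
                                   (reach-cons s (path-reach-trans π ρ))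

    reach-trans : ∀ {x y z r r′} → Reach w x y r → Reach w y z r′ → Reach w x z (r + r′)
    reach-trans {r′ = r′} (ℓ , π , ℓ≤r) ρ =
      reach-weaken (+-monoˡ-≤ r′ ℓ≤r) (path-reach-trans π ρ)

    path-reverse : ∀ {x y ℓ} → Path w x y ℓ → Reach w y x ℓ
    path-reverse stay    = reach-refl
    path-reverse (s ▸ π) = reach-weaken (≤-reflexive (+-comm _ _))
      (reach-trans (path-reverse π) (reach-step (reverse-step s)))

    reach-sym : ∀ {x y r} → Reach w x y r → Reach w y x r
    reach-sym (ℓ , π , ℓ≤r) = reach-weaken ℓ≤r (path-reverse π)

    reach-⊓ : ∀ {x y r r′} → Reach w x y r → Reach w x y r′ → Reach w x y (r ⊓ r′)
    reach-⊓ {r = r} {r′} ρ ρ′ with ⊓-sel r r′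
    ... | inj₁ ⊓≈r  = reach-weaken (≤-reflexive (sym ⊓≈r)) ρ
    ... | inj₂ ⊓≈r′ = reach-weaken (≤-reflexive (sym ⊓≈r′)) ρ′

    lipschitz-path : ∀ {f} → Lipschitz w f → ∀ {x y ℓ} → Path w x y ℓ → f x ≤ ℓ + f y
    lipschitz-path lip stay    = ≤-reflexive (sym (+-identityˡ _))
    lipschitz-path {f} lip (_▸_ {x} {y} {z} {a} {b} s π) = begin
      f x              ≤⟨ lip s ⟩
      a + f y          ≤⟨ +-monoʳ-≤ a (lipschitz-path lip π) ⟩
      a + (b + f z)    ≈⟨ +-assoc a b (f z) ⟨
      (a + b) + f z    ∎

    isDistance : ∀ {x y r} → Reach w x y r → (∀ ℓ → Path w x y ℓ → r ≤ ℓ) →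
                 IsDistance w x y r
    isDistance (ℓ , π , ℓ≤r) minimal = (ℓ , π , antisym ℓ≤r (minimal ℓ π)) , minimal

  -- Distance functions attained by shortest paths.

  record Distances {G : MetricGraph} {k : ℕ} (w : Wormholes G k) : Set where
    field
      d          : Point G → Point G → ℝ
      d-distance : ∀ x y → IsDistance w x y (d x y)

    reach-d : ∀ x y → Reach w x y (d x y)
    reach-d x y = let (ℓ , π , ℓ≈d) , _ = d-distance x y in ℓ , π , ≤-reflexive ℓ≈d

    d-minimal : ∀ {x y r} → Reach w x y r → d x y ≤ r
    d-minimal {x} {y} (ℓ , π , ℓ≤r) = ≤-trans (proj₂ (d-distance x y) ℓ π) ℓ≤r

    d-nonneg : ∀ x y → 0# ≤ d x y
    d-nonneg x y = let (ℓ , π , ℓ≈d) , _ = d-distance x y in ≤-respʳ-≈ ℓ≈d (path-nonneg π)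

    d-refl : ∀ x → d x x ≤ 0#
    d-refl x = d-minimal reach-refl

    d-sym : ∀ x y → d x y ≤ d y x
    d-sym x y = d-minimal (reach-sym (reach-d y x))

    d-triangle : ∀ x y z → d x z ≤ d x y + d y z
    d-triangle x y z = d-minimal (reach-trans (reach-d x y) (reach-d y z))

    d-lipschitz : ∀ z → Lipschitz w (λ x → d x z)
    d-lipschitz z {y = y} s = d-minimal (reach-cons s (reach-d y z))

  -- A Lipschitz function drops by at most `ℓ` along a path of length `ℓ`, so
  -- `d x y ≤ ℓ + d y y ≤ ℓ`; values that are reached by paths are therefore minimal.
  distances : ∀ {G k} {w : Wormholes G k} (d : Point G → Point G → ℝ) →
              (∀ x y → Reach w x y (d x y)) → (∀ x → d x x ≤ 0#) →
              (∀ z → Lipschitz w (λ x → d x z)) → Distances w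
  distances {w = w} d reach d-refl d-lipschitz = record
    { d          = d
    ; d-distance = λ x y → isDistance {w = w} (reach x y) λ ℓ π → begin
        d x y       ≤⟨ lipschitz-path (d-lipschitz y) π ⟩
        ℓ + d y y   ≤⟨ +-monoʳ-≤ ℓ (d-refl y) ⟩
        ℓ + 0#      ≈⟨ +-identityʳ ℓ ⟩
        ℓ           ∎
    }

  -- Adding one wormhole to known distances.

  module AddWormhole {G : MetricGraph} {k : ℕ} (w : Wormholes G (ℕ.suc k))
                     (D : Distances (w ∘ suc)) where
    open Distances D

    p q : Point G
    p = proj₁ (w zero)
    q = proj₂ (w zero)

    -- The terms are the routes that avoid the new wormhole, cross it from `p` to `q`, and cross it
    -- from `q` to `p`; a second crossing gains nothing.
    d′ : Point G → Point G → ℝ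
    d′ x y = d x y ⊓ ((d x p + d q y) ⊓ (d x q + d p y))

    d′≤d : ∀ x y → d′ x y ≤ d x y
    d′≤d x y = x⊓y≤x _ _

    d′≤via-pq : ∀ x y → d′ x y ≤ d x p + d q y
    d′≤via-pq x y = ≤-trans (x⊓y≤y _ _) (x⊓y≤x _ _)

    d′≤via-qp : ∀ x y → d′ x y ≤ d x q + d p y
    d′≤via-qp x y = ≤-trans (x⊓y≤y _ _) (x⊓y≤y _ _)

    weaken-step : ∀ {x y a} → Step (w ∘ suc) x y a → Step w x y a
    weaken-step (forward t≤u)    = forward t≤u
    weaken-step (backward u≤t)   = backward u≤t
    weaken-step (fromSource t≈0) = fromSource t≈0
    weaken-step (toSource t≈0)   = toSource t≈0
    weaken-step (fromTarget t≈w) = fromTarget t≈w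
    weaken-step (toTarget t≈w)   = toTarget t≈w
    weaken-step (jump j)         = jump (suc j)
    weaken-step (jumpBack j)     = jumpBack (suc j)

    weaken-path : ∀ {x y ℓ} → Path (w ∘ suc) x y ℓ → Path w x y ℓ
    weaken-path stay    = stay
    weaken-path (s ▸ π) = weaken-step s ▸ weaken-path π

    reach-old : ∀ x y → Reach w x y (d x y)
    reach-old x y = let ℓ , π , ℓ≤d = reach-d x y in ℓ , weaken-path π , ℓ≤d

    reach-via : ∀ {u v} → Step w u v 0# → ∀ x y → Reach w x y (d x u + d v y)
    reach-via {u} {v} s x y = reach-trans (reach-old x u)
      (reach-weaken (≤-reflexive (+-identityˡ _)) (reach-cons s (reach-old v y)))

    reach-d′ : ∀ x y → Reach w x y (d′ x y)
    reach-d′ x y = reach-⊓ (reach-old x y)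
      (reach-⊓ (reach-via (jump zero) x y) (reach-via (jumpBack zero) x y))

    lipschitz-old : ∀ z {x y a} → Step (w ∘ suc) x y a → d′ x z ≤ a + d′ y z
    lipschitz-old z {x} {y} {a} s = ≤+⊓
      (≤-trans (d′≤d x z) (d-lipschitz z s))
      (≤+⊓ (≤-trans (d′≤via-pq x z) (via p q)) (≤-trans (d′≤via-qp x z) (via q p)))
      where
      via : ∀ u v → d x u + d v z ≤ a + (d y u + d v z)
      via u v = ≤-trans (+-monoˡ-≤ (d v z) (d-lipschitz u s)) (≤-reflexive (+-assoc _ _ _))

    module _ {u v z : Point G} {r : ℝ} where

      -- For a jump from `u` to `v`, the three hop lemmas bound the new distance `r` from `u` to `z`
      -- by the three terms of the one from `v` to `z`: going straight on, returning to `u` by old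
      -- paths and jumping again, or jumping back.
      hop-direct : r ≤ d u u + d v z → r ≤ 0# + d v z
      hop-direct r≤ = ≤-trans r≤ (+-monoˡ-≤ (d v z) (d-refl u))

      hop-detour : r ≤ d u u + d v z → r ≤ 0# + (d v u + d v z)
      hop-detour r≤ = ≤-trans (hop-direct r≤) (+-monoʳ-≤ 0# (≤-stepˡ (d-nonneg v u) ≤-refl))

      hop-back : r ≤ d u z → r ≤ 0# + (d v v + d u z)
      hop-back r≤ = ≤-stepˡ ≤-refl (≤-stepˡ (d-nonneg v v) r≤)

    lipschitz-d′ : ∀ z → Lipschitz w (λ x → d′ x z)
    lipschitz-d′ z (forward t≤u)    = lipschitz-old z (forward t≤u)
    lipschitz-d′ z (backward u≤t)   = lipschitz-old z (backward u≤t)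
    lipschitz-d′ z (fromSource t≈0) = lipschitz-old z (fromSource t≈0)
    lipschitz-d′ z (toSource t≈0)   = lipschitz-old z (toSource t≈0)
    lipschitz-d′ z (fromTarget t≈w) = lipschitz-old z (fromTarget t≈w)
    lipschitz-d′ z (toTarget t≈w)   = lipschitz-old z (toTarget t≈w)
    lipschitz-d′ z (jump (suc j))     = lipschitz-old z (jump j)
    lipschitz-d′ z (jumpBack (suc j)) = lipschitz-old z (jumpBack j)
    lipschitz-d′ z (jump zero) = ≤+⊓ (hop-direct (d′≤via-pq p z))
      (≤+⊓ (hop-detour (d′≤via-pq p z)) (hop-back (d′≤d p z)))
    lipschitz-d′ z (jumpBack zero) = ≤+⊓ (hop-direct (d′≤via-qp q z))
      (≤+⊓ (hop-back (d′≤d q z)) (hop-detour (d′≤via-qp q z)))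

    extended : Distances w
    extended = distances d′ reach-d′ (λ x → ≤-trans (d′≤d x x) (d-refl x)) lipschitz-d′

  -- Attained maxima and the diameter.

  module _ {G : MetricGraph} {k : ℕ} {w : Wormholes G k} where

    step-along : ∀ {e t u 0≤t t≤w 0≤u u≤w} →
                 Reach w (onEdge e t 0≤t t≤w) (onEdge e u 0≤u u≤w) (gap t u)
    step-along {t = t} {u} with total t u
    ... | inj₁ t≤u = reach-weaken (x≤y+z⇒x-z≤y (u≤gap+t t u)) (reach-step (forward t≤u))
    ... | inj₂ u≤t = reach-weaken (x≤y+z⇒x-z≤y (t≤gap+u t u)) (reach-step (backward u≤t))

    lipschitz-reach : ∀ {f} → Lipschitz w f → ∀ {x y r} → Reach w x y r → f x ≤ r + f y
    lipschitz-reach {f} lip {y = y} (ℓ , π , ℓ≤r) =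
      ≤-trans (lipschitz-path lip π) (+-monoˡ-≤ (f y) ℓ≤r)

    module _ (em : ExcludedMiddle 0ℓ) {f : Point G → ℝ} (f-lipschitz : Lipschitz w f) where

      point-on : (e : Fin (#E G)) → Interval (weight G e) → Point G
      point-on e (t , 0≤t , t≤w) = onEdge e t 0≤t t≤w

      -- Positions at most `r` apart on an edge are joined by a path of length at most `r`, so `f`
      -- restricted to the edge is Lipschitz on an interval.
      edge-max : ∀ e → ∃ λ c → ∀ y → f (point-on e y) ≤ f (point-on e c)
      edge-max e = lipschitz-attains-max em (proj₁ (0<weight G e)) (f ∘ point-on e)
        λ {r} y z y≤r+z z≤r+y → lipschitz-reach f-lipschitz
          (reach-weaken (gap≤ y≤r+z z≤r+y) step-along)

      -- Vertices are listed besides the edge maxima because a vertex is a point distinct from the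
      -- edge ends glued to it. `x₀` is the start value of `argmax`.
      graph-max : Point G → ∃ λ c → ∀ x → f x ≤ f c
      graph-max x₀ = c , maximal
        where
        edge-maximum : Fin (#E G) → Point G
        edge-maximum e = point-on e (proj₁ (edge-max e))

        candidates : List (Point G)
        candidates = map vertex (allFin (#V G)) ++ map edge-maximum (allFin (#E G))

        c : Point G
        c = Extrema.argmax totalOrder f x₀ candidates

        candidate≤ : ∀ {x} → x ∈ candidates → f x ≤ f c
        candidate≤ = All.lookup (Extrema.f[xs]≤f[argmax] totalOrder {f = f} x₀ candidates)

        maximal : ∀ x → f x ≤ f c
        maximal (vertex v)           = candidate≤ (∈-++⁺ˡ (∈-map⁺ vertex (∈-allFin v)))
        maximal (onEdge e t 0≤t t≤w) =
          ≤-trans (proj₂ (edge-max e) (t , 0≤t , t≤w))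
            (candidate≤ (∈-++⁺ʳ _ (∈-map⁺ edge-maximum (∈-allFin e))))

    diameter : ExcludedMiddle 0ℓ → Distances w → Point G → ∃ (IsDiameter w)
    diameter em D x₀ =
      ecc y* , (far y* , y* , d-distance (far y*) y*) ,
      λ x y → d x y , d-distance x y , ≤-trans (d≤ecc x y) (ecc≤ y)
      where
      open Distances D

      farthest : ∀ y → ∃ λ c → ∀ x → d x y ≤ d c y
      farthest y = graph-max em (d-lipschitz y) x₀

      far : Point G → Point G
      far y = proj₁ (farthest y)

      ecc : Point G → ℝ
      ecc y = d (far y) y

      d≤ecc : ∀ x y → d x y ≤ ecc y
      d≤ecc x y = proj₂ (farthest y) x

      -- The point farthest from `y` is at most `ecc y′` away from `y′`, and one step changes its
      -- distance by at most `a`.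
      ecc-lipschitz : Lipschitz w ecc
      ecc-lipschitz {y} {y′} {a} s = begin
        d (far y) y         ≤⟨ d-sym (far y) y ⟩
        d y (far y)         ≤⟨ d-lipschitz (far y) s ⟩
        a + d y′ (far y)    ≤⟨ +-monoʳ-≤ a (d-sym y′ (far y)) ⟩
        a + d (far y) y′    ≤⟨ +-monoʳ-≤ a (d≤ecc (far y) y′) ⟩
        a + d (far y′) y′   ∎

      central = graph-max em ecc-lipschitz x₀

      y* : Point G
      y* = proj₁ central

      ecc≤ : ∀ y → ecc y ≤ ecc y*
      ecc≤ = proj₂ central

-- Distances in the star without wormholes.

module Stars (R : RealNumbers) where
  open RealNumbers R hiding (zero)
  open MetricGraphs R
  open OrderedField R
  open Travel R
  open CommutativeSemigroupProperties +-commutativeSemigroup using (interchange)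
  open PartialOrderReasoning (TotalOrder.poset totalOrder)
  open Min totalOrder using (_⊓_; minOperator)
  open import Algebra.Construct.NaturalChoice.MinOp minOperator
    using (⊓-glb; x⊓y≤x; x⊓y≤y)

  2# : ℝ
  2# = 1# + 1#

  module _ {n : ℕ} where

    -- The centre lies on every spike; spike 0 is an arbitrary choice.
    spike : Point (star (ℕ.suc n)) → Fin (ℕ.suc n)
    spike (vertex zero)    = zero
    spike (vertex (suc i)) = i
    spike (onEdge e _ _ _) = e

    height : Point (star (ℕ.suc n)) → ℝ
    height (vertex zero)    = 0#
    height (vertex (suc i)) = 1#
    height (onEdge _ t _ _) = t

    0≤height : ∀ x → 0# ≤ height x
    0≤height (vertex zero)      = ≤-refl
    0≤height (vertex (suc i))   = 0≤1
    0≤height (onEdge _ _ 0≤t _) = 0≤t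

    height≤1 : ∀ x → height x ≤ 1#
    height≤1 (vertex zero)      = 0≤1
    height≤1 (vertex (suc i))   = ≤-refl
    height≤1 (onEdge _ _ _ t≤1) = t≤1

    -- Replacing a vertex by an edge end glued to it, at no cost, lets routes be built on edges
    -- only.
    onSpike : Point (star (ℕ.suc n)) → Point (star (ℕ.suc n))
    onSpike x = onEdge (spike x) (height x) (0≤height x) (height≤1 x)

    -- The decision is an argument so that proofs can split on it without unfolding `starDist`.
    spikeDist : {e f : Fin (ℕ.suc n)} → Dec (e ≡ f) → ℝ → ℝ → ℝ
    spikeDist (yes _) t u = gap t u
    spikeDist (no _)  t u = t + u

    starDist : Point (star (ℕ.suc n)) → Point (star (ℕ.suc n)) → ℝ
    starDist x y = spikeDist (spike x ≟ spike y) (height x) (height y)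

    spikeDist-lipschitz : ∀ {e f} (e≟f : Dec (e ≡ f)) {t u v r} → t ≤ r + u → u ≤ r + t →
                          spikeDist e≟f t v ≤ r + spikeDist e≟f u v
    spikeDist-lipschitz (yes _)        t≤r+u u≤r+t = gap-lipschitz t≤r+u u≤r+t
    spikeDist-lipschitz (no _) {v = v} t≤r+u u≤r+t =
      ≤-trans (+-monoˡ-≤ v t≤r+u) (≤-reflexive (+-assoc _ _ v))

    -- At height zero |t - u| and `t + u` both equal `u`, so the spike assigned to the centre does
    -- not affect distances.
    spikeDist≤ : ∀ {e f} (e≟f : Dec (e ≡ f)) {t u} → t ≈ 0# → 0# ≤ u → spikeDist e≟f t u ≤ u
    spikeDist≤ (yes _) {t} {u} t≈0 0≤u = gap≤
      (≤-trans (≤-reflexive t≈0) (+-nonneg 0≤u 0≤u))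
      (begin
        u       ≈⟨ +-identityʳ u ⟨
        u + 0#  ≈⟨ +-congˡ t≈0 ⟨
        u + t   ∎)
    spikeDist≤ (no _) t≈0 0≤u = +-nonposˡ (≤-reflexive t≈0) ≤-refl

    ≤spikeDist : ∀ {e f} (e≟f : Dec (e ≡ f)) {t u} → t ≈ 0# → u ≤ spikeDist e≟f t u
    ≤spikeDist (yes _) {t} {u} t≈0 = begin
      u             ≤⟨ u≤gap+t t u ⟩
      gap t u + t   ≈⟨ +-congˡ t≈0 ⟩
      gap t u + 0#  ≈⟨ +-identityʳ _ ⟩
      gap t u       ∎
    ≤spikeDist (no _) t≈0 = ≤-stepˡ (≤-reflexive (sym t≈0)) ≤-refl

    spikeDist-distinct : ∀ {e f} (e≟f : Dec (e ≡ f)) → e ≢ f → ∀ {t u} →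
                         t + u ≤ spikeDist e≟f t u
    spikeDist-distinct (yes e≡f) e≢f = ⊥-elim (e≢f e≡f)
    spikeDist-distinct (no _)    e≢f = ≤-refl

    starDist-near-centre : ∀ x y z → height x ≈ 0# → height y ≈ 0# →
                           starDist x z ≤ 0# + starDist y z
    starDist-near-centre x y z x≈0 y≈0 = ≤-stepˡ ≤-refl (≤-trans
      (spikeDist≤ (spike x ≟ spike z) x≈0 (0≤height z))
      (≤spikeDist (spike y ≟ spike z) y≈0))

    starDist-refl : ∀ x → starDist x x ≤ 0#
    starDist-refl x with spike x ≟ spike x
    ... | yes _ = gap≤ (≤-stepˡ ≤-refl ≤-refl) (≤-stepˡ ≤-refl ≤-refl)
    ... | no ≢  = ⊥-elim (≢ ≡.refl)

    module _ {k : ℕ} {w : Wormholes (star (ℕ.suc n)) k} where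

      to-onSpike : ∀ x → Reach w x (onSpike x) 0#
      to-onSpike (vertex zero)    = reach-step (fromSource refl)
      to-onSpike (vertex (suc i)) = reach-step (fromTarget refl)
      to-onSpike (onEdge _ _ _ _) = reach-refl

      between-spikes : ∀ {x y r} → Reach w (onSpike x) (onSpike y) r → Reach w x y r
      between-spikes {x} {y} ρ =
        reach-weaken (≤-reflexive (trans (+-identityˡ _) (+-identityʳ _)))
          (reach-trans (to-onSpike x) (reach-trans ρ (reach-sym (to-onSpike y))))

      to-centre : ∀ {e t 0≤t t≤1} → Reach w (onEdge e t 0≤t t≤1) centre t
      to-centre {0≤t = 0≤t} = reach-weaken
        (≤-trans (≤-reflexive (+-identityʳ _))
          (x≤y+z⇒x-z≤y (≤-reflexive (sym (+-identityʳ _)))))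
        (reach-cons (backward {0≤u = ≤-refl} {u≤w = 0≤1} 0≤t)
          (reach-step (toSource refl)))

      via-centre : ∀ x y → Reach w x y (height x + height y)
      via-centre x y = between-spikes (reach-trans to-centre (reach-sym to-centre))

      reach-starDist : ∀ x y → Reach w x y (starDist x y)
      reach-starDist x y with spike x ≟ spike y
      ... | yes x≡y = between-spikes (along x≡y)
        where
        along : ∀ {e f t u 0≤t t≤1 0≤u u≤1} → e ≡ f →
                Reach w (onEdge e t 0≤t t≤1) (onEdge f u 0≤u u≤1) (gap t u)
        along ≡.refl = step-along
      ... | no _    = via-centre x y

      to-tip : ∀ {e t 0≤t t≤1} → Reach w (onEdge e t 0≤t t≤1) (tip e) (1# - t)
      to-tip {t≤1 = t≤1} = reach-weaken (≤-reflexive (+-identityʳ _))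
        (reach-cons (forward {0≤u = 0≤1} {u≤w = ≤-refl} t≤1)
          (reach-step (toTarget refl)))

    starDistances : (w : Wormholes (star (ℕ.suc n)) 0) → Distances w
    starDistances w = distances starDist reach-starDist starDist-refl lip
      where
      same-height : ∀ {e f t u v} (e≟f : Dec (e ≡ f)) → t ≈ u →
                    spikeDist e≟f t v ≤ 0# + spikeDist e≟f u v
      same-height e≟f t≈u = spikeDist-lipschitz e≟f
        (≤-stepˡ ≤-refl (≤-reflexive t≈u)) (≤-stepˡ ≤-refl (≤-reflexive (sym t≈u)))

      lip : ∀ z → Lipschitz w (λ x → starDist x z)
      lip z (forward {e} {t} {u} t≤u) = spikeDist-lipschitz (e ≟ spike z)
        (≤-stepˡ (0≤y-x t≤u) t≤u) (≤-reflexive (sym ([y-x]+x≈y t u)))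
      lip z (backward {e} {t} {u} u≤t) = spikeDist-lipschitz (e ≟ spike z)
        (≤-reflexive (sym ([y-x]+x≈y u t))) (≤-stepˡ (0≤y-x u≤t) u≤t)
      -- The centre is assigned to spike `zero`, so this step can change the spike, but both ends
      -- have height zero.
      lip z {x} {y} (fromSource t≈0) = starDist-near-centre x y z refl t≈0
      lip z {x} {y} (toSource t≈0)   = starDist-near-centre x y z t≈0 refl
      lip z (fromTarget {e} t≈1)     = same-height (e ≟ spike z) (sym t≈1)
      lip z (toTarget {e} t≈1)       = same-height (e ≟ spike z) t≈1
      lip z (jump ())
      lip z (jumpBack ())

    -- Separated spikes and the effect of a wormhole on them.

    wormholeDistances : ∀ {k} (w : Wormholes (star (ℕ.suc n)) k) → Distances w
    wormholeDistances {ℕ.zero}  w = starDistances w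
    wormholeDistances {ℕ.suc k} w = AddWormhole.extended w (wormholeDistances (w ∘ suc))

    -- `σ` lists the surviving spikes, so removing one is composition with `punchIn`.
    Separated : ∀ {k m} {w : Wormholes (star (ℕ.suc n)) k} →
                Distances w → (Fin m → Fin (ℕ.suc n)) → Set
    Separated D σ = (∀ i → 1# ≤ d centre (tip (σ i)))
                  × (∀ i j → i ≢ j → 2# ≤ d (tip (σ i)) (tip (σ j)))
      where open Distances D

    star-separated : ∀ w → Separated (starDistances w) id
    star-separated w =
      (λ i → ≤spikeDist (zero ≟ i) refl) , (λ i j i≢j → spikeDist-distinct (i ≟ j) i≢j)

    module RemoveSpike {k m} (w : Wormholes (star (ℕ.suc n)) (ℕ.suc k))
                       (D : Distances (w ∘ suc)) (σ : Fin (ℕ.suc m) → Fin (ℕ.suc n))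
                       (separated : Separated D σ) where
      open Distances D
      open AddWormhole w D using (p; q; d′; extended)

      -- What routes crossing from `p` to `q` must satisfy for the spikes other than `x` to stay
      -- separated.
      FarVia : Point (star (ℕ.suc n)) → Point (star (ℕ.suc n)) → Fin (ℕ.suc m) → Set
      FarVia p q x = (∀ i → i ≢ x → 1# ≤ d centre p + d q (tip (σ i)))
                   × (∀ i j → i ≢ x → j ≢ x → 2# ≤ d (tip (σ i)) p + d q (tip (σ j)))

      -- The hypotheses say that no tip is closer to `p` or `q` than the tip of `x` is to `p`.
      module _ {p q : Point (star (ℕ.suc n))} {x : Fin (ℕ.suc m)}
               (≤p : ∀ i → d (tip (σ x)) p ≤ d (tip (σ i)) p)
               (≤q : ∀ i → d (tip (σ x)) p ≤ d (tip (σ i)) q) where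

        x-far : ∀ i → i ≢ x → 2# ≤ d (tip (σ i)) p + d (tip (σ x)) p
        x-far i i≢x = begin
          2#                                      ≤⟨ proj₂ separated i x i≢x ⟩
          d (tip (σ i)) (tip (σ x))               ≤⟨ d-triangle _ p _ ⟩
          d (tip (σ i)) p + d p (tip (σ x))       ≤⟨ +-monoʳ-≤ _ (d-sym p _) ⟩
          d (tip (σ i)) p + d (tip (σ x)) p       ∎

        -- Of two tips at distance at least two, the one farther from `p` is at least one away from
        -- it.
        1≤p : ∀ i → i ≢ x → 1# ≤ d (tip (σ i)) p
        1≤p i i≢x = +-halving-≤ (≤-trans (x-far i i≢x) (+-monoʳ-≤ _ (≤p i)))

        far-pq : FarVia p q x
        far-pq = centre-far , tips-far
          where
          -- Going from `p` straight to the tip of `x` instead is no longer, and that old route has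
          -- length at least one.
          centre-far : ∀ i → i ≢ x → 1# ≤ d centre p + d q (tip (σ i))
          centre-far i i≢x = begin
            1#                            ≤⟨ proj₁ separated x ⟩
            d centre (tip (σ x))          ≤⟨ d-triangle _ p _ ⟩
            d centre p + d p (tip (σ x))  ≤⟨ +-monoʳ-≤ _ (d-sym p _) ⟩
            d centre p + d (tip (σ x)) p  ≤⟨ +-monoʳ-≤ _ (≤q i) ⟩
            d centre p + d (tip (σ i)) q  ≤⟨ +-monoʳ-≤ _ (d-sym _ q) ⟩
            d centre p + d q (tip (σ i))  ∎

          -- The same replacement gives an old route between the tips of `i` and `x`.
          tips-far : ∀ i j → i ≢ x → j ≢ x → 2# ≤ d (tip (σ i)) p + d q (tip (σ j))
          tips-far i j i≢x _ = begin
            2#                                 ≤⟨ x-far i i≢x ⟩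
            d (tip (σ i)) p + d (tip (σ x)) p  ≤⟨ +-monoʳ-≤ _ (≤q j) ⟩
            d (tip (σ i)) p + d (tip (σ j)) q  ≤⟨ +-monoʳ-≤ _ (d-sym _ q) ⟩
            d (tip (σ i)) p + d q (tip (σ j))  ∎

        far-qp : FarVia q p x
        far-qp = centre-far , tips-far
          where
          -- The part from `p` to the tip of `i` alone has length at least one.
          centre-far : ∀ i → i ≢ x → 1# ≤ d centre q + d p (tip (σ i))
          centre-far i i≢x =
            ≤-stepˡ (d-nonneg centre q) (≤-trans (1≤p i i≢x) (d-sym _ p))

          -- The part from the tip of `i` to `q` is at least as long as one from the tip of `x` to
          -- `p`, which leaves an old route between the tips of `x` and `j`.
          tips-far : ∀ i j → i ≢ x → j ≢ x → 2# ≤ d (tip (σ i)) q + d p (tip (σ j))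
          tips-far i j i≢x j≢x = begin
            2#                                 ≤⟨ x-far j j≢x ⟩
            d (tip (σ j)) p + d (tip (σ x)) p  ≈⟨ +-comm _ _ ⟩
            d (tip (σ x)) p + d (tip (σ j)) p  ≤⟨ +-mono-≤ (≤q i) (d-sym _ p) ⟩
            d (tip (σ i)) q + d p (tip (σ j))  ∎

      nearness : Fin (ℕ.suc m) → ℝ
      nearness i = d (tip (σ i)) p ⊓ d (tip (σ i)) q

      closest : Fin (ℕ.suc m)
      closest = proj₁ (minimiser nearness)

      closest≤ : ∀ i → nearness closest ≤ nearness i
      closest≤ = proj₂ (minimiser nearness)

      nearness-of : ∀ {x r} → r ≤ nearness x → (∀ i → nearness x ≤ nearness i) →
                    (∀ i → r ≤ d (tip (σ i)) p) × (∀ i → r ≤ d (tip (σ i)) q)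
      nearness-of r≤ x≤ =
        (λ i → ≤-trans (≤-trans r≤ (x≤ i)) (x⊓y≤x _ _)) ,
        (λ i → ≤-trans (≤-trans r≤ (x≤ i)) (x⊓y≤y _ _))

      -- Whichever of `p` and `q` is nearer to the tip of `x` plays the part of `p` in `far-pq` and
      -- `far-qp`.
      far-via-nearest : ∀ x → (∀ i → nearness x ≤ nearness i) → FarVia p q x × FarVia q p x
      far-via-nearest x x≤ = [ p-nearer , q-nearer ]′ (total _ _)
        where
        p-nearer : d (tip (σ x)) p ≤ d (tip (σ x)) q → FarVia p q x × FarVia q p x
        p-nearer p≤q = let ≤p , ≤q = nearness-of {x} (⊓-glb ≤-refl p≤q) x≤
                       in far-pq ≤p ≤q , far-qp ≤p ≤q

        q-nearer : d (tip (σ x)) q ≤ d (tip (σ x)) p → FarVia p q x × FarVia q p x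
        q-nearer q≤p = let ≤p , ≤q = nearness-of {x} (⊓-glb q≤p ≤-refl) x≤
                       in far-qp ≤q ≤p , far-pq ≤q ≤p

      far-via : FarVia p q closest × FarVia q p closest
      far-via = far-via-nearest closest closest≤

      still-separated : Separated extended (σ ∘ punchIn closest)
      still-separated = centre-far , tips-far
        where
        centre-far : ∀ i → 1# ≤ d′ centre (tip (σ (punchIn closest i)))
        centre-far i = ⊓-glb (proj₁ separated _)
          (⊓-glb (proj₁ (proj₁ far-via) _ (punchInᵢ≢i closest i))
                 (proj₁ (proj₂ far-via) _ (punchInᵢ≢i closest i)))

        tips-far : ∀ i j → i ≢ j →
                   2# ≤ d′ (tip (σ (punchIn closest i))) (tip (σ (punchIn closest j)))
        tips-far i j i≢j = ⊓-glb
          (proj₂ separated _ _ (i≢j ∘ punchIn-injective closest i j))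
          (⊓-glb (proj₂ (proj₁ far-via) _ _ (punchInᵢ≢i closest i) (punchInᵢ≢i closest j))
                 (proj₂ (proj₂ far-via) _ _ (punchInᵢ≢i closest i) (punchInᵢ≢i closest j)))

    -- Each wormhole costs one spike: before `w zero` is added there are `suc m` separated spikes,
    -- afterwards `m`.
    separated-spikes : ∀ {k} m (w : Wormholes (star (ℕ.suc n)) k) → k ℕ.+ m ≡ ℕ.suc n →
                       ∃ λ σ → Separated {m = m} (wormholeDistances w) σ
    separated-spikes {ℕ.zero}  m w ≡.refl = id , star-separated w
    separated-spikes {ℕ.suc k} m w k+m≡n =
      let σ , separated = separated-spikes (ℕ.suc m) (w ∘ suc)
                            (≡.trans (ℕ.+-suc k m) k+m≡n)
          open RemoveSpike w (wormholeDistances (w ∘ suc)) σ separated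
      in σ ∘ punchIn closest , still-separated

    -- The spike of full length and the diameter bound.

    full-spike : (w : Wormholes (star (ℕ.suc n)) n) →
                 ∃ λ i → IsDistance w centre (tip i) 1#
    full-spike w = σ zero , isDistance
      (reach-weaken (≤-reflexive (+-identityˡ 1#)) (via-centre centre (tip (σ zero))))
      λ ℓ π → ≤-trans (proj₁ separated zero) (d-minimal (ℓ , π , ≤-refl))
      where
      open Distances (wormholeDistances w)
      -- With `n` wormholes and `suc n` spikes, one spike remains.
      spikes = separated-spikes 1 w (ℕ.+-comm n 1)
      σ = proj₁ spikes
      separated = proj₂ spikes

    diameter≥1 : ExcludedMiddle 0ℓ → (w : Wormholes (star (ℕ.suc n)) n) →
                 ∃ λ D → IsDiameter w D × 1# ≤ D
    diameter≥1 em w =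
      let D , D-max , D-bounds = diameter em (wormholeDistances w) centre
          i , (ℓ , π , ℓ≈1) , 1≤ = full-spike w
          d , ((ℓ′ , π′ , ℓ′≈d) , _) , d≤D = D-bounds centre (tip i)
      -- `D-bounds` supplies its own distance `d`, so the bound goes through the path `π′` that
      -- realises it.
      in D , (D-max , D-bounds) , ≤-trans (1≤ ℓ′ π′) (≤-trans (≤-reflexive ℓ′≈d) d≤D)

    -- Tightness: all tips identified.

    tipsJoined : Wormholes (star (ℕ.suc n)) n
    tipsJoined j = tip zero , tip (suc j)

    to-first-tip : ∀ i → Reach tipsJoined (tip i) (tip zero) 0#
    to-first-tip zero    = reach-refl
    to-first-tip (suc i) = reach-step (jumpBack i)

    via-tips : ∀ x y → Reach tipsJoined x y ((1# - height x) + (1# - height y))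
    via-tips x y = between-spikes (reach-trans (up x) (reach-sym (up y)))
      where
      up : ∀ x → Reach tipsJoined (onSpike x) (tip zero) (1# - height x)
      up x = reach-weaken (≤-reflexive (+-identityʳ _))
               (reach-trans to-tip (to-first-tip (spike x)))

    reach-within-1 : ∀ x y → Reach tipsJoined x y 1#
    reach-within-1 x y with total (height x + height y) 1#
    ... | inj₁ t+u≤1 = reach-weaken t+u≤1 (via-centre x y)
    -- Adding `t + u` to both sides turns the claim 2 - t - u ≤ 1 into 2 ≤ 1 + (t + u).
    ... | inj₂ 1≤t+u = reach-weaken (+-cancelʳ-≤ (t + u) (begin
      ((1# - t) + (1# - u)) + (t + u)   ≈⟨ interchange (1# - t) (1# - u) t u ⟩
      ((1# - t) + t) + ((1# - u) + u)   ≈⟨ +-cong ([y-x]+x≈y t 1#) ([y-x]+x≈y u 1#) ⟩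
      1# + 1#                           ≤⟨ +-monoʳ-≤ 1# 1≤t+u ⟩
      1# + (t + u)                      ∎)) (via-tips x y)
      where
      t = height x
      u = height y

    tipsJoined-diameter : IsDiameter tipsJoined 1#
    tipsJoined-diameter =
      -- The pair at distance one comes from the lower bound, which holds for every choice of
      -- wormholes.
      (centre , tip (proj₁ spike₁) , proj₂ spike₁) ,
      λ x y → d x y , d-distance x y , d-minimal (reach-within-1 x y)
      where
      open Distances (wormholeDistances tipsJoined)
      spike₁ = full-spike tipsJoined

proposition9 : ExcludedMiddle 0ℓ → (R : RealNumbers) →
    let open RealNumbers R
        open MetricGraphs R
    in (s : ℕ) .{{_ : NonZero s}} →
       ((w : Wormholes (star s) (pred s)) →
          (∃ λ i → IsDistance w centre (tip i) 1#) ×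
          (∃ λ D → IsDiameter w D × 1# ≤ D)) ×
       (∃ λ (w : Wormholes (star s) (pred s)) → IsDiameter w 1#)
proposition9 em R (ℕ.suc n) =
  (λ w → full-spike w , diameter≥1 em w) , (tipsJoined , tipsJoined-diameter)
  where open Stars R
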